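{- For every integer $n>0$, we have $T(n)=P(n)/3$ if and only if $n=A(k)$ for some positive integer $k$.
   Context: The sequence $A$ (OEIS A000975: $1,2,5,10,21,42,85,\dots$) is defined by $A(1)=1$, $A(2m)=2A(2m-1)$ and $A(2m+1)=2A(2m)+1$ for $m\ge 1$. $T(n)=n(n+1)/2$ is the $n$th triangular number. $P(n)$, for $n\ge 1$, is the $n$th smallest positive integer whose binary representation (without leading zeros) has even length and is a palindrome (OEIS A048701); thus $P(1)=3=11_{(2)}$, $P(2)=9=1001_{(2)}$, $P(3)=15=1111_{(2)}$, $P(4)=33=100001_{(2)}$, $P(5)=45=101101_{(2)}$. -}

module Defs where

open import Data.Digit using (Bit; 0b; 1b; fromDigits)
open import Data.Fin.Base as Fin using (toℕ)
import Data.Fin.Properties as Fin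
open import Data.List.Base using (List; []; _∷_; _++_; length; reverse; last)
open import Data.List.Properties using (≡-dec; reverse-++; reverse-involutive; length-++; length-reverse)
open import Data.Maybe.Base using (just)
open import Data.Nat.Base
open import Data.Nat.Divisibility using (_∣_; _∣?_; divides)
open import Data.Nat.DivMod using ([m+kn]%n≡m%n; m<n⇒m%n≡m)
open import Data.Nat.Properties
open import Data.Product.Base using (∃; ∃-syntax; _×_; _,_; proj₁; proj₂)
open import Data.Sum.Base using (inj₁; inj₂)
open import Relation.Binary.PropositionalEquality
open import Relation.Nullary.Decidable using (map′; yes; no; _×-dec_)
open import Relation.Nullary.Negation using (¬_; contradiction)
open import Relation.Unary using (Decidable)

T : ℕ → ℕ
T n = n * (n + 1) / 2

-- The recurrence A(2m) = 2A(2m-1), A(2m+1) = 2A(2m) + 1, extended by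
-- A(0) = 0, from which it yields A(1) = 1.
A : ℕ → ℕ
A zero    = 0
A (suc k) = 2 * A k + suc k % 2

A-one : A 1 ≡ 1
A-one = refl

A-even : ∀ m → A (2 * suc m) ≡ 2 * A (2 * suc m ∸ 1)
A-even m = trans (cong (2 * A (2 * suc m ∸ 1) +_) p) (+-identityʳ _)
  where
  p : (2 * suc m) % 2 ≡ 0
  p = trans (cong (_% 2) (*-comm 2 (suc m))) ([m+kn]%n≡m%n 0 (suc m) 2)

A-odd : ∀ m → A (2 * m + 1) ≡ 2 * A (2 * m) + 1
A-odd m = trans (cong A (+-comm (2 * m) 1)) (cong (2 * A (2 * m) +_) p)
  where
  p : suc (2 * m) % 2 ≡ 1
  p = trans (cong (λ z → suc z % 2) (*-comm 2 m)) ([m+kn]%n≡m%n 1 m 2)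

-- Digits are listed from the least significant one (the convention of
-- fromDigits), so the absence of leading zeros is a condition on the
-- last element of the list.
IsBinaryRepresentation : ℕ → List Bit → Set
IsBinaryRepresentation n ds = fromDigits ds ≡ n × last ds ≡ just 1b

EvenLengthPalindrome : ℕ → Set
EvenLengthPalindrome n =
  ∃[ ds ] IsBinaryRepresentation n ds × 2 ∣ length ds × reverse ds ≡ ds

private
  increment : List Bit → List Bit
  increment []                       = 1b ∷ []
  increment (Fin.zero         ∷ ds) = 1b ∷ ds
  increment (Fin.suc Fin.zero ∷ ds) = 0b ∷ increment ds

  fromDigits-increment : ∀ ds → fromDigits (increment ds) ≡ suc (fromDigits ds)
  fromDigits-increment []                       = refl
  fromDigits-increment (Fin.zero         ∷ ds) = refl
  fromDigits-increment (Fin.suc Fin.zero ∷ ds) = cong (_* 2) (fromDigits-increment ds)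

  last-∷ : ∀ {b : Bit} d ds → last ds ≡ just b → last (d ∷ ds) ≡ just b
  last-∷ d (_ ∷ _) eq = eq

  last-++ : ∀ {b : Bit} ds es → last es ≡ just b → last (ds ++ es) ≡ just b
  last-++ []       es eq = eq
  last-++ (d ∷ ds) es eq = last-∷ d (ds ++ es) (last-++ ds es eq)

  last-0∷ : ∀ ds → last (0b ∷ ds) ≡ just 1b → last (1b ∷ ds) ≡ just 1b
  last-0∷ (_ ∷ _) eq = eq

  last-increment : ∀ ds → last ds ≡ just 1b → last (increment ds) ≡ just 1b
  last-increment (Fin.zero         ∷ ds)         eq = last-0∷ ds eq
  last-increment (Fin.suc Fin.zero ∷ [])         eq = refl
  last-increment (Fin.suc Fin.zero ∷ ds@(_ ∷ _)) eq = last-∷ 0b (increment ds) (last-increment ds eq)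

binaryRepresentation : ∀ n → ∃ (IsBinaryRepresentation (suc n))
binaryRepresentation zero    = 1b ∷ [] , refl , refl
binaryRepresentation (suc n) with binaryRepresentation n
... | ds , value , nz =
  increment ds , trans (fromDigits-increment ds) (cong suc value) , last-increment ds nz

private
  digit-% : ∀ (r : Bit) q → (toℕ r + q * 2) % 2 ≡ toℕ r
  digit-% r q = trans ([m+kn]%n≡m%n (toℕ r) q 2) (m<n⇒m%n≡m (Fin.toℕ<n r))

  digit-unique : ∀ (r s : Bit) p q → toℕ r + p * 2 ≡ toℕ s + q * 2 → r ≡ s
  digit-unique r s p q eq =
    Fin.toℕ-injective (trans (sym (digit-% r p)) (trans (cong (_% 2) eq) (digit-% s q)))

  fromDigits≢0 : ∀ ds → last ds ≡ just 1b → fromDigits {2} ds ≢ 0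
  fromDigits≢0 (Fin.zero ∷ ds@(_ ∷ _)) nz eq = fromDigits≢0 ds nz (*-cancelʳ-≡ _ 0 2 eq)

  fromDigits-injective : ∀ ds es → last ds ≡ just 1b → last es ≡ just 1b →
                         fromDigits {2} ds ≡ fromDigits es → ds ≡ es
  fromDigits-injective (d ∷ ds) (e ∷ es) nzᵈ nzᵉ eq
    with refl ← digit-unique d e (fromDigits ds) (fromDigits es) eq
    = cong (d ∷_) (tails ds es nzᵈ nzᵉ
        (*-cancelʳ-≡ (fromDigits ds) (fromDigits es) 2 (+-cancelˡ-≡ (toℕ d) _ _ eq)))
    where
    tails : ∀ ds es → last (d ∷ ds) ≡ just 1b → last (d ∷ es) ≡ just 1b →
            fromDigits ds ≡ fromDigits es → ds ≡ es
    tails []         []         _   _   _  = refl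
    tails []         es@(_ ∷ _) _   nzᵉ eq = contradiction (sym eq) (fromDigits≢0 es nzᵉ)
    tails ds@(_ ∷ _) []         nzᵈ _   eq = contradiction eq (fromDigits≢0 ds nzᵈ)
    tails ds@(_ ∷ _) es@(_ ∷ _) nzᵈ nzᵉ eq = fromDigits-injective ds es nzᵈ nzᵉ eq

IsBinaryRepresentation-unique : ∀ {n ds es} →
  IsBinaryRepresentation n ds → IsBinaryRepresentation n es → ds ≡ es
IsBinaryRepresentation-unique {ds = ds} {es} (vᵈ , nzᵈ) (vᵉ , nzᵉ) =
  fromDigits-injective ds es nzᵈ nzᵉ (trans vᵈ (sym vᵉ))

evenLengthPalindrome? : Decidable EvenLengthPalindrome
evenLengthPalindrome? zero    = no λ (ds , (value , nz) , _) → fromDigits≢0 ds nz value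
evenLengthPalindrome? (suc n) with binaryRepresentation n
... | ds , rep = map′ (λ p → ds , rep , p) only
                      ((2 ∣? length ds) ×-dec ≡-dec Fin._≟_ (reverse ds) ds)
  where
  only : EvenLengthPalindrome (suc n) → 2 ∣ length ds × reverse ds ≡ ds
  only (es , rep′ , p) with refl ← IsBinaryRepresentation-unique {ds = ds} {es} rep rep′ = p

private
  fromDigits-++ʳ : ∀ (ds es : List Bit) → fromDigits es ≤ fromDigits (ds ++ es)
  fromDigits-++ʳ []       es = ≤-refl
  fromDigits-++ʳ (d ∷ ds) es =
    ≤-trans (fromDigits-++ʳ ds es) (≤-trans (m≤m*n _ 2) (m≤n+m _ (toℕ d)))

evenLengthPalindrome-unbounded : ∀ n → ∃[ m ] n < m × EvenLengthPalindrome m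
evenLengthPalindrome-unbounded n with binaryRepresentation n
... | ds , value , nz =
  fromDigits w , subst (_≤ fromDigits w) value (fromDigits-++ʳ (reverse ds) ds) ,
  w , (refl , last-++ (reverse ds) ds nz) , even , palindrome
  where
  w = reverse ds ++ ds
  palindrome : reverse w ≡ w
  palindrome = trans (reverse-++ (reverse ds) ds) (cong (reverse ds ++_) (reverse-involutive ds))
  even : 2 ∣ length w
  even = divides (length ds) (trans (length-++ (reverse ds))
    (trans (cong (_+ length ds) (length-reverse ds))
    (trans (cong (length ds +_) (sym (+-identityʳ _))) (*-comm 2 (length ds)))))

Least : (ℕ → Set) → (ℕ → Set)
Least S n = S n × (∀ m → m < n → ¬ S m)

least : ∀ {S} → Decidable S → ∃ S → ∃ (Least S)
least {S} S? (n , Sn) = search n 0 (λ _ ()) (subst S (sym (+-identityʳ n)) Sn)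
  where
  search : ∀ d x → (∀ m → m < x → ¬ S m) → S (d + x) → ∃ (Least S)
  search d x below Sd with S? x
  search d       x below Sd | yes Sx = x , Sx , below
  search zero    x below Sd | no ¬Sx = contradiction Sd ¬Sx
  search (suc d) x below Sd | no ¬Sx = search d (suc x) below′ (subst S (sym (+-suc d x)) Sd)
    where
    below′ : ∀ m → m < suc x → ¬ S m
    below′ m m<1+x Sm with m≤n⇒m<n∨m≡n (s≤s⁻¹ m<1+x)
    ... | inj₁ m<x  = below m m<x Sm
    ... | inj₂ refl = ¬Sx Sm

nextEvenLengthPalindrome : ∀ n → ∃ (Least (λ m → n < m × EvenLengthPalindrome m))
nextEvenLengthPalindrome n =
  least (λ m → (n <? m) ×-dec evenLengthPalindrome? m) (evenLengthPalindrome-unbounded n)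

-- P 0 = 0 only starts the enumeration: it makes P 1 the least positive
-- even-length palindrome.
P : ℕ → ℕ
P zero    = 0
P (suc n) = proj₁ (nextEvenLengthPalindrome (P n))

P-spec : ∀ n → Least (λ m → P n < m × EvenLengthPalindrome m) (P (suc n))
P-spec n = proj₂ (nextEvenLengthPalindrome (P n))

{-# OPTIONS --safe #-}

-- For an m-digit n put N = 2 ^ m and let R be the value of its reversed
-- digits. The even-length palindromes are exactly the values
-- P n = R + n * N, so 3 T(n) = P(n) reads 3n(n+1) = 2Nn + 2R.
-- Since 2R < 2N ≤ 4n, this gives 2N ≤ 3(n+1) < 2N + 4, while
-- 2N = 3 A(m) + 1 or 2N = 3 A(m) + 2; hence n = A(m). Conversely the digits
-- of A(m) alternate, so R = A(m) for odd m and 2R = A(m) for even m.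
module Submission where

open import Defs
open import Data.Digit using (Bit; 1b; fromDigits)
import Data.Fin.Base as Fin
import Data.Fin.Properties as Fin
open import Data.Integer.Base using (+_)
import Data.Integer.Properties as ℤ
open import Data.List.Base using (List; []; _∷_; _++_; length; reverse; last; take; drop)
open import Data.List.Properties
  using (length-++; length-drop; length-reverse; length-take; reverse-++; reverse-involutive;
         take++drop≡id; unfold-reverse; ∷-injectiveˡ; ∷-injectiveʳ)
open import Data.Maybe.Base using (just)
open import Data.Nat.Base hiding (_/_)
open import Data.Nat.Divisibility using (_∣_; divides; divides-refl)
open import Data.Nat.DivMod using (_mod_; _%_; m%n<n; m/n*n≡m)
open import Data.Nat.Properties
open import Data.Nat.Tactic.RingSolver using (solve-∀)
open import Data.Product.Base using (∃-syntax; _×_; _,_; proj₁; proj₂)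
open import Data.Rational.Base using (_/_)
open import Data.Rational.Properties using (fromℚᵘ-cong; fromℚᵘ-injective)
open import Data.Rational.Unnormalised.Base using (mkℚᵘ; *≡*)
open import Data.Sum.Base using (_⊎_; inj₁; inj₂)
open import Function.Bundles using (_⇔_; mk⇔; module Equivalence)
open import Relation.Binary.Definitions using (tri<; tri≈; tri>)
open import Relation.Binary.PropositionalEquality
  using (_≡_; refl; sym; trans; cong; cong₂; subst; module ≡-Reasoning)
open import Relation.Nullary.Negation using (¬_; contradiction)

-- Values of digit lists

value : List Bit → ℕ
value = fromDigits

value-++ : ∀ ds es → value (ds ++ es) ≡ value ds + value es * 2 ^ length ds
value-++ []       es = sym (*-identityʳ (value es))
value-++ (d ∷ ds) es = trans (cong (λ v → Fin.toℕ d + v * 2) (value-++ ds es))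
  (rearrange (Fin.toℕ d) (value ds) (value es) (2 ^ length ds))
  where
  rearrange : ∀ d v w n → d + (v + w * n) * 2 ≡ d + v * 2 + w * (2 * n)
  rearrange = solve-∀

value<2^length : ∀ ds → value ds < 2 ^ length ds
value<2^length []       = s≤s z≤n
value<2^length (d ∷ ds) = begin-strict
  Fin.toℕ d + value ds * 2  <⟨ +-monoˡ-< (value ds * 2) (Fin.toℕ<n d) ⟩
  suc (value ds) * 2        ≤⟨ *-monoˡ-≤ 2 (value<2^length ds) ⟩
  2 ^ length ds * 2         ≡⟨ *-comm (2 ^ length ds) 2 ⟩
  2 * 2 ^ length ds         ∎
  where open ≤-Reasoning

-- The leading digit 1 alone contributes half of `2 ^ length ds`; doubling the value avoids a
-- predecessor in the exponent.
2^length≤2*value : ∀ ds → last ds ≡ just 1b → 2 ^ length ds ≤ 2 * value ds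
2^length≤2*value (_ ∷ []) refl = ≤-refl
2^length≤2*value (d ∷ ds@(_ ∷ _)) nz = *-monoʳ-≤ 2 (begin
  2 ^ length ds             ≤⟨ 2^length≤2*value ds nz ⟩
  2 * value ds              ≡⟨ *-comm 2 (value ds) ⟩
  value ds * 2              ≤⟨ m≤n+m _ (Fin.toℕ d) ⟩
  Fin.toℕ d + value ds * 2  ∎)
  where open ≤-Reasoning

0<value : ∀ ds → last ds ≡ just 1b → 0 < value ds
0<value ds nz = *-cancelˡ-< 2 0 (value ds)
  (<-≤-trans (m^n>0 2 (length ds)) (2^length≤2*value ds nz))

binaryDigits : ℕ → List Bit
binaryDigits zero    = []
binaryDigits (suc n) = proj₁ (binaryRepresentation n)

value-binaryDigits : ∀ n → value (binaryDigits n) ≡ n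
value-binaryDigits zero    = refl
value-binaryDigits (suc n) = proj₁ (proj₂ (binaryRepresentation n))

last-binaryDigits : ∀ {n} → 0 < n → last (binaryDigits n) ≡ just 1b
last-binaryDigits {suc n} _ = proj₂ (proj₂ (binaryRepresentation n))

binaryDigits-unique : ∀ {n} ds → IsBinaryRepresentation n ds → ds ≡ binaryDigits n
binaryDigits-unique ds (refl , nz) = IsBinaryRepresentation-unique (refl , nz)
  (value-binaryDigits (value ds) , last-binaryDigits (0<value ds nz))

-- The bound is stated with 1 + 2 * n so that it includes n = 0, whose
-- digit list is empty.
2^length-binaryDigits≤ : ∀ n → 2 ^ length (binaryDigits n) ≤ 1 + 2 * n
2^length-binaryDigits≤ zero      = ≤-refl
2^length-binaryDigits≤ n@(suc _) = m≤n⇒m≤1+n (subst (λ v → 2 ^ length (binaryDigits n) ≤ 2 * v)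
  (value-binaryDigits n) (2^length≤2*value (binaryDigits n) (last-binaryDigits {n} z<s)))

-- If `n` had fewer digits than `m`, then `2 * n` would be at most `2 ^ length (binaryDigits m)`,
-- which the leading digit of `m` bounds by `1 + 2 * m`.
length-binaryDigits-mono : ∀ {m n} → m < n → length (binaryDigits m) ≤ length (binaryDigits n)
length-binaryDigits-mono {m} {n} m<n = ≮⇒≥ λ shorter → <-irrefl refl (begin-strict
  1 + 2 * m                        <⟨ n<1+n _ ⟩
  2 + 2 * m                        ≡⟨ *-suc 2 m ⟨
  2 * suc m                        ≤⟨ *-monoʳ-≤ 2 m<n ⟩
  2 * n                            ≡⟨ cong (2 *_) (value-binaryDigits n) ⟨
  2 * value (binaryDigits n)       ≤⟨ *-monoʳ-≤ 2 (<⇒≤ (value<2^length (binaryDigits n))) ⟩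
  2 ^ suc (length (binaryDigits n)) ≤⟨ ^-monoʳ-≤ 2 shorter ⟩
  2 ^ length (binaryDigits m)      ≤⟨ 2^length-binaryDigits≤ m ⟩
  1 + 2 * m                        ∎)
  where open ≤-Reasoning

-- Enumeration of the even-length palindromes

-- Digits run from the least significant, so `n` itself fills the upper half and its reversal the
-- lower half. At `n = 0` the value is 0, in agreement with `P 0`.
mirror : ℕ → ℕ
mirror n = value (reverse (binaryDigits n) ++ binaryDigits n)

mirror-value : ∀ n → mirror n ≡
  value (reverse (binaryDigits n)) + n * 2 ^ length (binaryDigits n)
mirror-value n = trans (value-++ (reverse ds) ds)
  (cong₂ (λ v l → value (reverse ds) + v * 2 ^ l) (value-binaryDigits n) (length-reverse ds))
  where ds = binaryDigits n

value-reverse<2^length : ∀ ds → value (reverse ds) < 2 ^ length ds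
value-reverse<2^length ds =
  subst (λ l → value (reverse ds) < 2 ^ l) (length-reverse ds) (value<2^length (reverse ds))

-- The lower half is too small to carry past the next multiple of `2 ^ length ds`, and the upper
-- half of the larger number already reaches that multiple.
mirror-mono-< : ∀ {m n} → m < n → mirror m < mirror n
mirror-mono-< {m} {n} m<n = begin-strict
  mirror m                              ≡⟨ mirror-value m ⟩
  value (reverse ds) + m * 2 ^ length ds <⟨ +-monoˡ-< _ (value-reverse<2^length ds) ⟩
  suc m * 2 ^ length ds                 ≤⟨ *-mono-≤ m<n (^-monoʳ-≤ 2 (length-binaryDigits-mono m<n)) ⟩
  n * 2 ^ length es                     ≤⟨ m≤n+m _ (value (reverse es)) ⟩
  value (reverse es) + n * 2 ^ length es ≡⟨ mirror-value n ⟨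
  mirror n                              ∎
  where
  open ≤-Reasoning
  ds = binaryDigits m
  es = binaryDigits n

mirror-cancel-< : ∀ {m n} → mirror m < mirror n → m < n
mirror-cancel-< {m} {n} lt with <-cmp m n
... | tri< m<n _ _ = m<n
... | tri≈ _ refl _ = contradiction lt (<-irrefl refl)
... | tri> _ _ n<m = contradiction lt (<-asym (mirror-mono-< n<m))

++-injectiveˡ : ∀ {a} {X : Set a} (ws xs : List X) {ys zs} → length ws ≡ length xs →
                ws ++ ys ≡ xs ++ zs → ws ≡ xs
++-injectiveˡ []       []       _  _    = refl
++-injectiveˡ (w ∷ ws) (x ∷ xs) eq eq′ =
  cong₂ _∷_ (∷-injectiveˡ eq′) (++-injectiveˡ ws xs (suc-injective eq) (∷-injectiveʳ eq′))

last-++-nonempty : ∀ {a} {X : Set a} (xs ys : List X) → 0 < length ys → last (xs ++ ys) ≡ last ys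
last-++-nonempty []           ys       _ = refl
last-++-nonempty (_ ∷ [])     (_ ∷ _)  _ = refl
last-++-nonempty (_ ∷ x ∷ xs) ys       p = last-++-nonempty (x ∷ xs) ys p

last-++ʳ : ∀ {a} {X : Set a} (xs ys : List X) {y} → last ys ≡ just y → last (xs ++ ys) ≡ just y
last-++ʳ xs ys@(_ ∷ _) eq = trans (last-++-nonempty xs ys z<s) eq

-- Cut the list in the middle: its reversal starts with the reversed second half, and comparing the
-- first `h` entries identifies this with the first half.
palindrome-halves : ∀ {a} {X : Set a} (xs : List X) h → length xs ≡ h * 2 → reverse xs ≡ xs →
                    ∃[ ys ] length ys ≡ h × xs ≡ reverse ys ++ ys
palindrome-halves xs h len pal = ys , length-ys ,
  trans (sym (take++drop≡id h xs)) (cong (_++ ys) front)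
  where
  open ≡-Reasoning
  ys = drop h xs
  h+h : length xs ≡ h + h
  h+h = trans len (trans (*-comm h 2) (cong (λ l → h + l) (+-identityʳ h)))
  length-ys : length ys ≡ h
  length-ys = trans (length-drop h xs) (trans (cong (_∸ h) h+h) (m+n∸m≡n h h))
  length-front : length (take h xs) ≡ h
  length-front = trans (length-take h xs) (trans (cong (h ⊓_) h+h) (m≤n⇒m⊓n≡m (m≤m+n h h)))
  front : take h xs ≡ reverse ys
  front = ++-injectiveˡ (take h xs) (reverse ys)
    (trans length-front (sym (trans (length-reverse ys) length-ys)))
    (begin
      take h xs ++ ys                   ≡⟨ take++drop≡id h xs ⟩
      xs                                ≡⟨ pal ⟨
      reverse xs                        ≡⟨ cong reverse (take++drop≡id h xs) ⟨
      reverse (take h xs ++ ys)         ≡⟨ reverse-++ (take h xs) ys ⟩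
      reverse ys ++ reverse (take h xs) ∎)

mirror-palindrome : ∀ {n} → 0 < n → EvenLengthPalindrome (mirror n)
mirror-palindrome {n} 0<n = reverse ds ++ ds ,
  (refl , last-++ʳ (reverse ds) ds (last-binaryDigits 0<n)) ,
  divides (length ds) even , palindrome
  where
  open ≡-Reasoning
  ds = binaryDigits n
  even : length (reverse ds ++ ds) ≡ length ds * 2
  even = begin
    length (reverse ds ++ ds)       ≡⟨ length-++ (reverse ds) ⟩
    length (reverse ds) + length ds ≡⟨ cong (_+ length ds) (length-reverse ds) ⟩
    length ds + length ds           ≡⟨ cong (λ l → length ds + l) (+-identityʳ (length ds)) ⟨
    2 * length ds                   ≡⟨ *-comm 2 (length ds) ⟩
    length ds * 2                   ∎
  palindrome : reverse (reverse ds ++ ds) ≡ reverse ds ++ ds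
  palindrome = trans (reverse-++ (reverse ds) ds) (cong (reverse ds ++_) (reverse-involutive ds))

-- The upper half inherits the leading 1 of the whole list, so by uniqueness it is the binary
-- representation of its own value.
mirror-surjective : ∀ {m} → EvenLengthPalindrome m → ∃[ n ] mirror n ≡ m
mirror-surjective (ws , (refl , nz) , divides h len , pal)
  with ds , length-ds , refl ← palindrome-halves ws h len pal
  = value ds , cong (λ es → value (reverse es ++ es))
      (sym (binaryDigits-unique ds (refl , last-ds ds nz)))
  where
  last-ds : ∀ ds → last (reverse ds ++ ds) ≡ just 1b → last ds ≡ just 1b
  last-ds ds@(_ ∷ _) nz = trans (sym (last-++-nonempty (reverse ds) ds z<s)) nz

Least-unique : ∀ {S m n} → Least S m → Least S n → m ≡ n
Least-unique {_} {m} {n} (Sm , below-m) (Sn , below-n) with <-cmp m n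
... | tri< m<n _ _ = contradiction Sm (below-n m m<n)
... | tri≈ _ m≡n _ = m≡n
... | tri> _ _ n<m = contradiction Sn (below-m n n<m)

-- A strictly increasing function that reaches every even-length palindrome, and whose values at
-- positive arguments are such palindromes, must enumerate them in order.
P≡mirror : ∀ n → P n ≡ mirror n
P≡mirror zero    = refl
P≡mirror (suc n) = Least-unique (P-spec n)
  ( (subst (_< mirror (suc n)) (sym (P≡mirror n)) (mirror-mono-< {n} (n<1+n n)) , mirror-palindrome {suc n} z<s)
  , λ m m<mirror (Pn<m , pal) → no-between m<mirror (subst (_< m) (P≡mirror n) Pn<m) pal)
  where
  no-between : ∀ {m} → m < mirror (suc n) → mirror n < m → ¬ EvenLengthPalindrome m
  no-between below above pal with k , refl ← mirror-surjective pal =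
    <⇒≱ (mirror-cancel-< {k} {suc n} below) (mirror-cancel-< {n} {k} above)

-- The sequence A

-- Both parities come in one case split, so that they can be abstracted together below; the
-- induction works because `suc (suc k) % 2` computes to `k % 2`.
consecutive-parities : ∀ k → (k % 2 ≡ 0 × suc k % 2 ≡ 1) ⊎ (k % 2 ≡ 1 × suc k % 2 ≡ 0)
consecutive-parities zero    = inj₁ (refl , refl)
consecutive-parities (suc k) with consecutive-parities k
... | inj₁ (even , odd) = inj₂ (odd , even)
... | inj₂ (odd , even) = inj₁ (even , odd)

-- The closed form of `A`, written additively to avoid truncated subtraction.
A-power : ∀ k → 2 * 2 ^ k + k % 2 ≡ 3 * A k + 2
A-power zero    = refl
A-power (suc k) with k % 2 | suc k % 2 | consecutive-parities k | A-power k
... | _ | _ | inj₁ (refl , refl) | eq =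
  trans (expand (2 ^ k)) (trans (cong (λ z → 2 * z + 1) eq) (collect (A k)))
  where
  expand : ∀ n → 2 * (2 * n) + 1 ≡ 2 * (2 * n + 0) + 1
  expand = solve-∀
  collect : ∀ a → 2 * (3 * a + 2) + 1 ≡ 3 * (2 * a + 1) + 2
  collect = solve-∀
-- Doubling the hypothesis exceeds the goal by 2 on each side, hence the cancellation.
... | _ | _ | inj₂ (refl , refl) | eq = +-cancelʳ-≡ 2 _ _
  (trans (expand (2 ^ k)) (trans (cong (2 *_) eq) (collect (A k))))
  where
  expand : ∀ n → 2 * (2 * n) + 0 + 2 ≡ 2 * (2 * n + 1)
  expand = solve-∀
  collect : ∀ a → 2 * (3 * a + 2) ≡ 3 * (2 * a + 0) + 2 + 2
  collect = solve-∀

-- The recurrence appends the parity of the index as a new lowest digit, which gives the alternating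
-- pattern 1, 10, 101, 1010.
digitsA : ℕ → List Bit
digitsA zero    = []
digitsA (suc k) = suc k mod 2 ∷ digitsA k

toℕ-mod : ∀ k → Fin.toℕ (k mod 2) ≡ k % 2
toℕ-mod k = Fin.toℕ-fromℕ< (m%n<n k 2)

length-digitsA : ∀ k → length (digitsA k) ≡ k
length-digitsA zero    = refl
length-digitsA (suc k) = cong suc (length-digitsA k)

digitsA-representation : ∀ k → 0 < k → IsBinaryRepresentation (A k) (digitsA k)
digitsA-representation k 0<k = digitsA-value k , digitsA-last 0<k
  where
  digitsA-value : ∀ k → value (digitsA k) ≡ A k
  digitsA-value zero    = refl
  digitsA-value (suc k) = trans (+-comm _ (value (digitsA k) * 2))
    (cong₂ _+_ (trans (*-comm (value (digitsA k)) 2) (cong (2 *_) (digitsA-value k))) (toℕ-mod (suc k)))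
  digitsA-last : ∀ {k} → 0 < k → last (digitsA k) ≡ just 1b
  digitsA-last {suc zero}    _ = refl
  digitsA-last {suc (suc k)} _ = digitsA-last {suc k} z<s

-- Reversal sends the new lowest digit to the top, with weight `2 ^ k`. If it is 1, `A-power`
-- evaluates that weight; if it is 0, the reversed value stays the same while `A` doubles and the
-- factor drops from 2 to 1.
value-reverse-digitsA : ∀ k → 2 * value (reverse (digitsA k)) ≡ (1 + k % 2) * A k
value-reverse-digitsA zero    = refl
value-reverse-digitsA (suc k) = trans (cong (2 *_) step) go
  where
  step : value (reverse (digitsA (suc k))) ≡ value (reverse (digitsA k)) + suc k % 2 * 2 ^ k
  step = trans (cong value (unfold-reverse (suc k mod 2) (digitsA k)))
    (trans (value-++ (reverse (digitsA k)) (suc k mod 2 ∷ []))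
    (cong₂ (λ b l → value (reverse (digitsA k)) + b * 2 ^ l)
      (trans (+-identityʳ _) (toℕ-mod (suc k)))
      (trans (length-reverse (digitsA k)) (length-digitsA k))))
  go : 2 * (value (reverse (digitsA k)) + suc k % 2 * 2 ^ k)
       ≡ (1 + suc k % 2) * (2 * A k + suc k % 2)
  go with k % 2 | suc k % 2 | consecutive-parities k | value-reverse-digitsA k | A-power k
  ... | _ | _ | inj₁ (refl , refl) | ih | power =
    trans (expand r (2 ^ k)) (trans (cong₂ _+_ ih power) (collect (A k)))
    where
    r = value (reverse (digitsA k))
    expand : ∀ r n → 2 * (r + 1 * n) ≡ 2 * r + (2 * n + 0)
    expand = solve-∀
    collect : ∀ a → (1 + 0) * a + (3 * a + 2) ≡ (1 + 1) * (2 * a + 1)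
    collect = solve-∀
  ... | _ | _ | inj₂ (refl , refl) | ih | _ =
    trans (cong (2 *_) (+-identityʳ (value (reverse (digitsA k))))) (trans ih (collect (A k)))
    where
    collect : ∀ a → (1 + 1) * a ≡ (1 + 0) * (2 * a + 0)
    collect = solve-∀

-- The equation 3 T(n) = P(n)

2*T : ∀ n → 2 * T n ≡ n * (n + 1)
2*T n = trans (*-comm 2 (T n)) (m/n*n≡m (pronic-even n))
  where
  pronic-even : ∀ n → 2 ∣ n * (n + 1)
  pronic-even zero    = divides-refl 0
  pronic-even (suc n) with divides q eq ← pronic-even n =
    divides (q + suc n) (trans (expand n) (trans (cong (_+ 2 * suc n) eq) (collect q n)))
    where
    expand : ∀ n → suc n * (suc n + 1) ≡ n * (n + 1) + 2 * suc n
    expand = solve-∀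
    collect : ∀ q n → q * 2 + 2 * suc n ≡ (q + suc n) * 2
    collect = solve-∀

2*P : ∀ n → 2 * P n ≡ 2 * value (reverse (binaryDigits n)) + n * (2 * 2 ^ length (binaryDigits n))
2*P n = trans (cong (2 *_) (trans (P≡mirror n) (mirror-value n)))
  (expand (value (reverse (binaryDigits n))) n (2 ^ length (binaryDigits n)))
  where
  expand : ∀ r n N → 2 * (r + n * N) ≡ 2 * r + n * (2 * N)
  expand = solve-∀

T*3-A : ∀ k → 0 < k → T (A k) * 3 ≡ P (A k)
T*3-A k 0<k = *-cancelˡ-≡ _ _ 2 (begin
  2 * (T a * 3)                  ≡⟨ *-assoc 2 (T a) 3 ⟨
  2 * T a * 3                    ≡⟨ cong (_* 3) (2*T a) ⟩
  a * (a + 1) * 3                ≡⟨ +-cancelʳ-≡ (a * 2) _ _ balance ⟩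
  (1 + b) * a + a * (2 * 2 ^ k)  ≡⟨ cong (_+ a * (2 * 2 ^ k)) (value-reverse-digitsA k) ⟨
  2 * value (reverse (digitsA k)) + a * (2 * 2 ^ k)
    ≡⟨ cong (λ l → 2 * value (reverse (digitsA k)) + a * (2 * 2 ^ l)) (length-digitsA k) ⟨
  2 * value (reverse (digitsA k)) + a * (2 * 2 ^ length (digitsA k))
    ≡⟨ cong (λ ds → 2 * value (reverse ds) + a * (2 * 2 ^ length ds))
         (binaryDigits-unique (digitsA k) (digitsA-representation k 0<k)) ⟩
  2 * value (reverse (binaryDigits a)) + a * (2 * 2 ^ length (binaryDigits a))
    ≡⟨ 2*P a ⟨
  2 * P a                        ∎)
  where
  open ≡-Reasoning
  a = A k
  b = k % 2
  balance : a * (a + 1) * 3 + a * 2 ≡ (1 + b) * a + a * (2 * 2 ^ k) + a * 2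
  -- Up to the common summand `a * 2`, the left side is `a + a * (3 * a + 2)`, and `A-power` turns
  -- the bracket into `2 * 2 ^ k + b`.
  balance = trans (left a) (trans (cong (λ z → a + a * z + a * 2) (sym (A-power k)))
    (right a b (2 ^ k)))
    where
    left : ∀ a → a * (a + 1) * 3 + a * 2 ≡ a + a * (3 * a + 2) + a * 2
    left = solve-∀
    right : ∀ a b N → a + a * (2 * N + b) + a * 2 ≡ (1 + b) * a + a * (2 * N) + a * 2
    right = solve-∀

-- The index is the number of digits of `n`. Both bounds carry a factor `n`, which cancels because
-- `n` is positive.
T*3≡P⇒A : ∀ n → 0 < n → T n * 3 ≡ P n → ∃[ k ] (0 < k × n ≡ A k)
T*3≡P⇒A n@(suc _) 0<n eq = k , 0<k , ≤-antisym n≤A A≤n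
  where
  open ≤-Reasoning
  ds = binaryDigits n
  k = length ds
  r = value (reverse ds)
  0<k : 0 < k
  0<k with ds | last-binaryDigits {n} 0<n
  ... | _ ∷ _ | _ = z<s
  equation : n * (3 * (n + 1)) ≡ 2 * r + n * (2 * 2 ^ k)
  equation = trans (rearrange n (n + 1)) (trans (cong (_* 3) (sym (2*T n)))
    (trans (*-assoc 2 (T n) 3) (trans (cong (2 *_) eq) (2*P n))))
    where
    rearrange : ∀ n m → n * (3 * m) ≡ n * m * 3
    rearrange = solve-∀
  -- The power `2 ^ k` separates the two: `r` has only `k` digits, and `n` has a leading 1 in
  -- position `k`.
  r<2n : r < 2 * n
  r<2n = <-≤-trans (value-reverse<2^length ds)
    (subst (λ v → 2 ^ k ≤ 2 * v) (value-binaryDigits n) (2^length≤2*value ds (last-binaryDigits 0<n)))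
  lower : 2 * 2 ^ k ≤ 3 * (n + 1)
  lower = *-cancelˡ-≤ n (begin
    n * (2 * 2 ^ k)         ≤⟨ m≤n+m _ (2 * r) ⟩
    2 * r + n * (2 * 2 ^ k) ≡⟨ equation ⟨
    n * (3 * (n + 1))       ∎)
  upper : 3 * (n + 1) < 2 * 2 ^ k + 4
  upper = *-cancelˡ-< n _ _ (begin-strict
    n * (3 * (n + 1))               ≡⟨ equation ⟩
    2 * r + n * (2 * 2 ^ k)         <⟨ +-monoˡ-< _ (*-monoʳ-< 2 r<2n) ⟩
    2 * (2 * n) + n * (2 * 2 ^ k)   ≡⟨ collect n (2 ^ k) ⟩
    n * (2 * 2 ^ k + 4)             ∎)
    where
    collect : ∀ n N → 2 * (2 * n) + n * (2 * N) ≡ n * (2 * N + 4)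
    collect = solve-∀
  A≤n : A k ≤ n
  -- Since `k % 2` is at most 1, `3 * A k + 2` is at most `3 * (n + 1) + 1`, which forces
  -- `A k < n + 1`.
  A≤n = s≤s⁻¹ (*-cancelˡ-< 3 (A k) (suc n) (+-cancelʳ-< 1 _ _ (begin-strict
    3 * A k + 1            <⟨ +-monoʳ-< (3 * A k) (n<1+n 1) ⟩
    3 * A k + 2            ≡⟨ A-power k ⟨
    2 * 2 ^ k + k % 2      ≤⟨ +-mono-≤ lower (s≤s⁻¹ (m%n<n k 2)) ⟩
    3 * (n + 1) + 1        ≡⟨ cong (λ m → 3 * m + 1) (+-comm n 1) ⟩
    3 * suc n + 1          ∎)))
  n≤A : n ≤ A k
  -- Strictness of `upper` matters: equality `3 * (n + 1) = 3 * (2 + A k)` would allow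
  -- `n = A k + 1`.
  n≤A = s≤s⁻¹ (s≤s⁻¹ (*-cancelˡ-< 3 (suc n) (2 + A k) (begin-strict
    3 * suc n              ≡⟨ cong (3 *_) (+-comm n 1) ⟨
    3 * (n + 1)            <⟨ upper ⟩
    2 * 2 ^ k + 4          ≤⟨ +-monoˡ-≤ 4 (m≤m+n (2 * 2 ^ k) (k % 2)) ⟩
    2 * 2 ^ k + k % 2 + 4  ≡⟨ cong (_+ 4) (A-power k) ⟩
    3 * A k + 2 + 4        ≡⟨ collect (A k) ⟩
    3 * (2 + A k)          ∎)))
    where
    collect : ∀ a → 3 * a + 2 + 4 ≡ 3 * (2 + a)
    collect = solve-∀

/1≡/3⇔*3≡ : ∀ m n → ((+ m) / 1 ≡ (+ n) / 3) ⇔ (m * 3 ≡ n)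
/1≡/3⇔*3≡ m n = mk⇔ to from
  where
  to : (+ m) / 1 ≡ (+ n) / 3 → m * 3 ≡ n
  -- Unnormalised fractions reduce equality to cross-multiplication; they store the denominator
  -- minus one, hence 0 and 2 for 1 and 3.
  to eq with *≡* eq′ ← fromℚᵘ-injective {mkℚᵘ (+ m) 0} {mkℚᵘ (+ n) 2} eq =
    ℤ.+-injective (trans (ℤ.pos-* m 3) (trans eq′ (ℤ.*-identityʳ (+ n))))
  from : m * 3 ≡ n → (+ m) / 1 ≡ (+ n) / 3
  from eq = fromℚᵘ-cong {mkℚᵘ (+ m) 0} {mkℚᵘ (+ n) 2}
    (*≡* (trans (sym (ℤ.pos-* m 3)) (trans (cong +_ eq) (sym (ℤ.*-identityʳ (+ n))))))

theorem3p2 : ∀ (n : ℕ) → 0 < n →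
    ((+ T n) / 1 ≡ (+ P n) / 3) ⇔ (∃[ k ] (0 < k × n ≡ A k))
theorem3p2 n 0<n = mk⇔
  (λ eq → T*3≡P⇒A n 0<n (Equivalence.to (/1≡/3⇔*3≡ (T n) (P n)) eq))
  λ { (k , 0<k , refl) → Equivalence.from (/1≡/3⇔*3≡ (T n) (P n)) (T*3-A k 0<k) }
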